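{- Let $n\in\mathbb{N}$ and let $\Gamma$ be a finite, non constant-satisfiable constraint language of $k$-ary Boolean relations. For $a,b\in\{0,1\}^n$, define $(a,b)\in\mathcal{E}$ if every instance of positive $\mathsf{CSP}(\Gamma)$ on $n$ variables that is satisfied by $a$ is also satisfied by $b$. Then the restriction of $\mathcal{E}$ to the set of non-constant assignments $\{0,1\}^n\setminus\{0^n,1^n\}$ is an equivalence relation.
   Context: An instance of positive $\mathsf{CSP}(\Gamma)$ on Boolean variables $x_1,\dots,x_n$ is a finite set of constraints $\{R,(x_{i_1},\dots,x_{i_k})\}$ with $R\in\Gamma$ and $(i_1,\dots,i_k)\in[n]^k$; an assignment $a\in\{0,1\}^n$ satisfies it if $(a_{i_1},\dots,a_{i_k})\in R$, and satisfies the instance if it satisfies all constraints. $\Gamma$ is non constant-satisfiable if there is no $\alpha\in\{0,1\}$ such that $\alpha^k\in R$ for every $R\in\Gamma$.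
   Formalization: Every relation in Γ is additionally assumed nonempty; without this the claim fails: for k = 1, Γ = {∅, {1}}, n = 3, the pair (001, 011) is in E but (011, 001) is not. -}

module Defs where

open import Data.Bool.Base using (Bool; true; false; T)
open import Data.Fin.Base using (Fin)
open import Data.List.Base using (List)
open import Data.List.Membership.Propositional using (_∈_)
open import Data.List.Relation.Unary.All using (All)
open import Data.Nat.Base using (ℕ)
open import Data.Product.Base using (Σ; ∃; _×_)
open import Data.Vec.Base using (Vec; lookup; map; replicate)
open import Level using (0ℓ)
open import Relation.Binary.Core using (Rel)
open import Relation.Binary.PropositionalEquality.Core using (_≢_)
open import Relation.Nullary.Negation.Core using (¬_)

private
  variable
    k n : ℕ

-- A subset of {0,1}^k, given by its characteristic function.
BoolRel : ℕ → Set
BoolRel k = Vec Bool k → Bool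

_∈ᴿ_ : Vec Bool k → BoolRel k → Set
t ∈ᴿ R = T (R t)

-- A finite set of k-ary relations, listed; order and repetition play no role,
-- as a language is only ever used through membership in the list.
Language : ℕ → Set
Language k = List (BoolRel k)

-- The usual convention that the relations of a constraint language are
-- nonempty.  It is not implied by NonConstantSatisfiable, which ∅ ∈ Γ satisfies
-- outright, and without it 𝓔 can fail to be symmetric: for Γ = {∅, {1}} with
-- k = 1 and n = 3, 𝓔 relates 001 to 011 but not 011 to 001.
NonemptyRelations : Language k → Set
NonemptyRelations Γ = ∀ R → R ∈ Γ → ∃ λ t → t ∈ᴿ R

ConstantSatisfiable : Language k → Set
ConstantSatisfiable {k} Γ = ∃ λ (α : Bool) → ∀ R → R ∈ Γ → replicate k α ∈ᴿ R

NonConstantSatisfiable : Language k → Set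
NonConstantSatisfiable Γ = ¬ ConstantSatisfiable Γ

record Constraint (Γ : Language k) (n : ℕ) : Set where
  field
    relation   : BoolRel k
    relation∈Γ : relation ∈ Γ
    scope      : Vec (Fin n) k

-- As with languages, a list stands for the finite set of its entries.
Instance : Language k → ℕ → Set
Instance Γ n = List (Constraint Γ n)

Assignment : ℕ → Set
Assignment n = Vec Bool n

SatisfiesConstraint : {Γ : Language k} → Assignment n → Constraint Γ n → Set
SatisfiesConstraint a C = map (lookup a) scope ∈ᴿ relation
  where open Constraint C

Satisfies : {Γ : Language k} → Assignment n → Instance Γ n → Set
Satisfies a I = All (SatisfiesConstraint a) I

𝓔 : (Γ : Language k) (n : ℕ) → Rel (Assignment n) 0ℓ
𝓔 Γ n a b = (I : Instance Γ n) → Satisfies a I → Satisfies b I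

NonConstant : Assignment n → Set
NonConstant {n} a = a ≢ replicate n false × a ≢ replicate n true

NonConstantAssignment : ℕ → Set
NonConstantAssignment n = Σ (Assignment n) NonConstant

{-# OPTIONS --safe #-}
-- Suppose a 𝓔 b.  If some i, j had a i ≢ a j but b i ≡ b j ≡ β, then a tuple t
-- of a relation R could be written as a ∘ s with s ranging over {i , j}, and
-- a 𝓔 b would put b ∘ s = βᵏ in R; as R is arbitrary, Γ would be
-- constant-satisfiable.  Hence a i ≢ a j forces b i ≢ b j.  This makes the set of
-- pairs (a i , b i) closed under swapping, and swapping the pairs along a scope
-- turns constraints preserved from a to b into constraints preserved from b to a.
module Submission where

open import Data.Bool.Base using (Bool; true; false; not)
open import Data.Bool.Properties using (_≟_; ¬-not)
open import Data.Fin.Base using (Fin)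
open import Data.Fin.Properties using (any?)
open import Data.List.Base using (_∷_; [])
open import Data.List.Membership.Propositional using (_∈_)
import Data.List.Relation.Unary.All as All
open import Data.Nat.Base using (ℕ)
open import Data.Product.Base using (∃; _×_; _,_; proj₁; proj₂)
open import Data.Vec.Base using (Vec; lookup; map; replicate)
open import Data.Vec.Properties using (map-∘; map-cong; map-id; map-const; lookup-replicate)
open import Data.Vec.Relation.Binary.Pointwise.Extensional using (ext; Pointwise-≡⇒≡)
open import Function.Base using (_∘_; _on_)
open import Relation.Binary.PropositionalEquality
  using (_≡_; _≢_; refl; sym; trans; subst; ≢-sym)
open import Relation.Binary.Structures using (IsEquivalence)
open import Relation.Nullary.Decidable using (yes; no)
open import Relation.Nullary.Negation using (contradiction)
open import Defs

private
  variable
    k n : ℕ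
    Γ : Language k
    R : BoolRel k
    a : Assignment n

≢∧≢⇒≡ : {x y z : Bool} → x ≢ z → y ≢ z → x ≡ y
≢∧≢⇒≡ x≢z y≢z = trans (¬-not x≢z) (sym (¬-not y≢z))

nonConstant⇒≢replicate : NonConstant a → ∀ β → a ≢ replicate _ β
nonConstant⇒≢replicate (a≢0 , _) false = a≢0
nonConstant⇒≢replicate (_ , a≢1) true  = a≢1

nonConstant⇒surjective : NonConstant a → ∀ β → ∃ λ i → lookup a i ≡ β
nonConstant⇒surjective {a = a} nc β with any? (λ i → lookup a i ≟ β)
... | yes hit = hit
-- Two Boolean values only: if `β` is never attained, `a` is `not β` everywhere.
... | no miss = contradiction
  (Pointwise-≡⇒≡ (ext λ i →
    trans (¬-not (λ eq → miss (i , eq))) (sym (lookup-replicate i (not β)))))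
  (nonConstant⇒≢replicate nc (not β))

-- Apply `𝓔` to the instance whose only constraint is `R` on `s`.
𝓔-constraint : ∀ a b → 𝓔 Γ n a b → R ∈ Γ → (s : Vec (Fin n) _) →
               map (lookup a) s ∈ᴿ R → map (lookup b) s ∈ᴿ R
𝓔-constraint _ _ aEb R∈Γ s a∈R =
  All.head (aEb (record { relation∈Γ = R∈Γ ; scope = s } ∷ []) (a∈R All.∷ All.[]))

-- Replacing each entry `x` of a tuple `t` by the position chosen for `x` gives a scope on which `a`
-- reads `t` and `b` reads `β` throughout.
𝓔-constant : ∀ a b → 𝓔 Γ n a b → NonemptyRelations Γ → (β : Bool) →
             (∀ x → ∃ λ i → lookup a i ≡ x × lookup b i ≡ β) →
             ConstantSatisfiable Γ
𝓔-constant a b aEb nonempty β pick = β , λ R R∈Γ →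
  let t , t∈R = nonempty R R∈Γ
      a∘s≡t = trans (sym (map-∘ (lookup a) index t))
                (trans (map-cong (proj₁ ∘ proj₂ ∘ pick) t) (map-id t))
      b∘s≡β = trans (sym (map-∘ (lookup b) index t))
                (trans (map-cong (proj₂ ∘ proj₂ ∘ pick) t) (map-const t β))
  in subst (_∈ᴿ R) b∘s≡β
       (𝓔-constraint a b aEb R∈Γ (map index t) (subst (_∈ᴿ R) (sym a∘s≡t) t∈R))
  where
  index : Bool → Fin _
  index = proj₁ ∘ pick

𝓔-separates : ∀ a b → 𝓔 Γ n a b → NonemptyRelations Γ → NonConstantSatisfiable Γ →
              ∀ i j → lookup a i ≢ lookup a j → lookup b i ≢ lookup b j
𝓔-separates a b aEb nonempty ncs i j ai≢aj bi≡bj =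
  ncs (𝓔-constant a b aEb nonempty (lookup b i) pick)
  where
  pick : ∀ x → ∃ λ l → lookup a l ≡ x × lookup b l ≡ lookup b i
  pick x with lookup a i ≟ x
  ... | yes ai≡x = i , ai≡x , refl
  -- `lookup a j` and `x` both differ from `lookup a i`, so they coincide.
  ... | no  ai≢x = j , ≢∧≢⇒≡ (≢-sym ai≢aj) (≢-sym ai≢x) , sym bi≡bj

-- When `a` and `b` differ at `i`, non-constancy supplies a `j` where `a` has the value
-- `lookup b i`. Separation then forces `b` to change between `i` and `j`, and the only other value
-- is `lookup a i`.
𝓔-swap : ∀ a b → 𝓔 Γ n a b → NonemptyRelations Γ → NonConstantSatisfiable Γ → NonConstant a →
         ∀ i → ∃ λ j → lookup a j ≡ lookup b i × lookup b j ≡ lookup a i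
𝓔-swap a b aEb nonempty ncs nc i with lookup a i ≟ lookup b i
... | yes ai≡bi = i , ai≡bi , sym ai≡bi
... | no  ai≢bi =
  let j , aj≡bi = nonConstant⇒surjective nc (lookup b i)
      ai≢aj = λ ai≡aj → ai≢bi (trans ai≡aj aj≡bi)
  in j , aj≡bi , ≢∧≢⇒≡ (≢-sym (𝓔-separates a b aEb nonempty ncs i j ai≢aj)) ai≢bi

𝓔-sym : NonemptyRelations Γ → NonConstantSatisfiable Γ → ∀ a b → NonConstant a →
        𝓔 Γ n a b → 𝓔 Γ n b a
𝓔-sym {Γ = Γ} nonempty ncs a b nc aEb I = All.map λ {C} → preserves C
  where
  swap = 𝓔-swap a b aEb nonempty ncs nc

  preserves : (C : Constraint Γ _) → SatisfiesConstraint b C → SatisfiesConstraint a C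
  -- On the scope of swapped positions `a` reads what `b` reads on `scope`, and conversely, so `aEb`
  -- used there carries `b∈R` to the claim for `a`.
  preserves C b∈R = subst (_∈ᴿ relation) b∘σ≡a
    (𝓔-constraint a b aEb relation∈Γ (map (proj₁ ∘ swap) scope)
      (subst (_∈ᴿ relation) (sym a∘σ≡b) b∈R))
    where
    open Constraint C
    a∘σ≡b = trans (sym (map-∘ (lookup a) (proj₁ ∘ swap) scope))
                  (map-cong (proj₁ ∘ proj₂ ∘ swap) scope)
    b∘σ≡a = trans (sym (map-∘ (lookup b) (proj₁ ∘ swap) scope))
                  (map-cong (proj₂ ∘ proj₂ ∘ swap) scope)

theorem4p3 : (n k : ℕ) (Γ : Language k) →
    NonemptyRelations Γ →
    NonConstantSatisfiable Γ →
    IsEquivalence {A = NonConstantAssignment n} (𝓔 Γ n on proj₁)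
theorem4p3 n k Γ nonempty ncs = record
  { refl  = λ I sat → sat
  ; sym   = λ {(a , nc)} {(b , _)} aEb → 𝓔-sym nonempty ncs a b nc aEb
  ; trans = λ aEb bEc I sat → bEc I (aEb I sat)
  }
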